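{- $\langle\vee\forall\rangle\not\le_{\sf m}\langle\forall\forall^\infty\forall\rangle$.
   Context: Quantifiers range over $\omega$. $\exists^\infty n\,\varphi(n)$ means $\forall m\exists n\ge m\,\varphi(n)$ and $\forall^\infty n\,\varphi(n)$ means $\exists m\forall n\ge m\,\varphi(n)$. Formulas considered are $\varphi(\bar x)\equiv\mathsf Q_0n_0\dots\mathsf Q_\ell n_\ell\,\theta(n_0,\dots,n_\ell,\bar x)$ with $\mathsf Q_i\in\{\exists,\forall,\exists^\infty,\forall^\infty\}$ and $\theta$ bounded. The instance $\bar x$ is a tuple of natural numbers and/or total computable functions (computable elements of $\omega^\omega$). Spaces such as $\omega\times\omega^\omega$, $(\omega^\omega)^\omega$, $\omega^{\omega\times\omega}$ are identified with $\omega^\omega$ by computable pairing. Witnesses: for $\alpha\in\omega^\omega$, $\alpha\Vdash\varphi(\bar x)$ ("$\alpha$ is a witness for $\varphi(\bar x)$") is defined by: $\alpha\Vdash\theta(\bar x)$ iff $\alpha=\bar x$ and $\theta(\bar x)$, for bounded $\theta$; $\langle t,\alpha\rangle\Vdash\exists n\varphi(n,\bar x)$ iff $\alpha\Vdash\varphi(t,\bar x)$; $\alpha\Vdash\forall n\varphi(n,\bar x)$ iff $\alpha(n)\Vdash\varphi(n,\bar x)$ for all $n$; $\langle t,\alpha\rangle\Vdash\forall^\infty n\varphi(n,\bar x)$ iff $\alpha(n)\Vdash\varphi(n,\bar x)$ for all $n\ge t$; $\alpha\Vdash\exists^\infty n\varphi(n,\bar x)$ iff for all $n$, writing $\alpha(n)=\langle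 k,\beta\rangle$, $k\ge n$ and $\beta\Vdash\varphi(k,\bar x)$. $\varphi\le_{\sf m}\psi$ if there are computable functions $\eta,r_-,r_+$ (type-two computable functionals, possibly partial but defined wherever required) such that for every instance $\bar x$: $\varphi(\bar x)$ is true iff $\psi(\eta(\bar x))$ is true; $\alpha\Vdash\varphi(\bar x)$ implies $r_-(\alpha,\bar x)\Vdash\psi(\eta(\bar x))$; $\alpha\Vdash\psi(\eta(\bar x))$ implies $r_+(\alpha,\bar x)\Vdash\varphi(\bar x)$ ($\alpha\in\omega^\omega$ arbitrary). $\langle\forall\forall^\infty\forall\rangle$ is a fixed complete formula of its pattern (every formula with that pattern is $\le_{\sf m}$-reducible to it), concretely $\langle\forall\forall^\infty\forall\rangle(x)\equiv\forall n\,\forall^\infty t\,\forall k.\ x(n,t,k)=0$. The formula $\langle\vee\forall\rangle$ is, for $x=(x_0,x_1)$ with $x_0,x_1\in\omega^\omega$ computable, $x_0=0^\infty\vee x_1=0^\infty$, read as $\exists i\in\{0,1\}\,\forall t.\ x_i(t)=0$; so a witness is essentially an $i\in\{0,1\}$ with $x_i=0^\infty$, where $0^\infty$ is the constantly zero sequence. -}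

module Defs where

open import Data.Fin using (Fin; zero; suc; toℕ)
open import Data.Nat using (ℕ; zero; suc; _+_; _*_; _≤_; _<_)
open import Data.Product using (Σ-syntax; ∃-syntax; _×_)
open import Data.Sum using (_⊎_)
open import Data.Vec using (Vec; []; _∷_; lookup)
open import Data.Vec.Relation.Unary.All using (All)
open import Function.Bundles using (_⇔_)
open import Relation.Binary.PropositionalEquality using (_≡_; _≗_)
open import Relation.Nullary using (¬_)

------------------------------------------------------------------------
-- Baire space

-- Functions are only ever compared pointwise (_≗_).
Baire : Set
Baire = ℕ → ℕ

0^∞ : Baire
0^∞ _ = 0

head : Baire → ℕ
head α = α 0

tail : Baire → Baire
tail α n = α (suc n)

-- The identification ω × ω^ω ≅ ω^ω:  ⟨ t , α ⟩ = cons t α.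
cons : ℕ → Baire → Baire
cons t α zero    = t
cons t α (suc n) = α n

-- The identification ω^ω × ω^ω ≅ ω^ω, by interleaving:
-- α 0 , β 0 , α 1 , β 1 , …
join : Baire → Baire → Baire
join α β zero    = head α
join α β (suc n) = join β (tail α) n

triangle : ℕ → ℕ
triangle zero    = 0
triangle (suc n) = suc n + triangle n

-- Cantor's bijection ω × ω ≅ ω.
pair : ℕ → ℕ → ℕ
pair m n = triangle (m + n) + n

-- The identification (ω^ω)^ω ≅ ω^ω:  column α n  is the n-th component
-- "α(n)" of α regarded as a sequence of elements of ω^ω.
column : Baire → ℕ → Baire
column α n k = α (pair n k)

------------------------------------------------------------------------
-- Computability: partial recursive functions relative to oracles

-- Program o k: k-ary partial recursive functions with o function oracles.
data Program (o : ℕ) : ℕ → Set where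
  zero   : Program o 0
  suc    : Program o 1
  proj   : ∀ {k} → Fin k → Program o k
  oracle : Fin o → Program o 1
  comp   : ∀ {k m} → Program o m → Vec (Program o k) m → Program o k
  prec   : ∀ {k} → Program o k → Program o (suc (suc k)) → Program o (suc k)
  mu     : ∀ {k} → Program o (suc k) → Program o k

infix 4 _⊢_[_]⇓_

-- γ ⊢ p [ xs ]⇓ y: with oracles γ, the program p halts on input xs with
-- output y.
data _⊢_[_]⇓_ {o : ℕ} (γ : Vec Baire o) :
              ∀ {k} → Program o k → Vec ℕ k → ℕ → Set where
  zero   : γ ⊢ zero [ [] ]⇓ 0
  suc    : ∀ {n} → γ ⊢ suc [ n ∷ [] ]⇓ suc n
  proj   : ∀ {k} {xs : Vec ℕ k} (i : Fin k) → γ ⊢ proj i [ xs ]⇓ lookup xs i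
  oracle : ∀ {n} (j : Fin o) → γ ⊢ oracle j [ n ∷ [] ]⇓ lookup γ j n
  comp   : ∀ {k m} {p : Program o m} {qs : Vec (Program o k) m}
             {xs : Vec ℕ k} {y : ℕ} (ys : Vec ℕ m) →
           (∀ i → γ ⊢ lookup qs i [ xs ]⇓ lookup ys i) →
           γ ⊢ p [ ys ]⇓ y →
           γ ⊢ comp p qs [ xs ]⇓ y
  prec-z : ∀ {k} {p : Program o k} {q : Program o (suc (suc k))}
             {xs : Vec ℕ k} {y : ℕ} →
           γ ⊢ p [ xs ]⇓ y →
           γ ⊢ prec p q [ 0 ∷ xs ]⇓ y
  prec-s : ∀ {k} {p : Program o k} {q : Program o (suc (suc k))}
             {xs : Vec ℕ k} {n y z : ℕ} →
           γ ⊢ prec p q [ n ∷ xs ]⇓ y →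
           γ ⊢ q [ n ∷ y ∷ xs ]⇓ z →
           γ ⊢ prec p q [ suc n ∷ xs ]⇓ z
  -- n is the least zero, and p converges to a positive value below n.
  mu     : ∀ {k} {p : Program o (suc k)} {xs : Vec ℕ k} {n : ℕ}
             (v : Fin n → ℕ) →
           (∀ i → γ ⊢ p [ toℕ i ∷ xs ]⇓ suc (v i)) →
           γ ⊢ p [ n ∷ xs ]⇓ 0 →
           γ ⊢ mu p [ xs ]⇓ n

-- A program p : Program o 1 is a partial computable functional
-- (ω^ω)^o ⇀ ω^ω; Maps p γ δ says that it is defined at γ with value δ.
Maps : ∀ {o} → Program o 1 → Vec Baire o → Baire → Set
Maps p γ δ = ∀ n → γ ⊢ p [ n ∷ [] ]⇓ δ n

Computable : Baire → Set
Computable f = Σ[ p ∈ Program 0 1 ] Maps p [] f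

------------------------------------------------------------------------
-- Formulas

-- Terms with a free number variables and b free function variables.
data Term (a b : ℕ) : Set where
  var     : Fin a → Term a b
  zero    : Term a b
  suc     : Term a b → Term a b
  _⊕_ _⊗_ : Term a b → Term a b → Term a b
  ⟪_,_⟫   : Term a b → Term a b → Term a b
  app     : Fin b → Term a b → Term a b

infix  7 _≐_ _≼_
infixr 6 _∧_
infixr 5 _∨_

-- Bounded formulas. Number variables are de Bruijn indices; the bound of a
-- quantifier is a term outside its scope.
data Bounded (a b : ℕ) : Set where
  _≐_ _≼_ : Term a b → Term a b → Bounded a b
  not     : Bounded a b → Bounded a b
  _∧_ _∨_ : Bounded a b → Bounded a b → Bounded a b
  all<    : Term a b → Bounded (suc a) b → Bounded a b
  ex<     : Term a b → Bounded (suc a) b → Bounded a b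

data Quantifier : Set where
  ∃' ∀' ∃∞ ∀∞ : Quantifier

data Formula (a b : ℕ) : Set where
  matrix : Bounded a b → Formula a b
  quant  : Quantifier → Formula (suc a) b → Formula a b

⟦_⟧ᵗ : ∀ {a b} → Term a b → Vec ℕ a → Vec Baire b → ℕ
⟦ var i ⟧ᵗ     ns fs = lookup ns i
⟦ zero ⟧ᵗ      ns fs = 0
⟦ suc t ⟧ᵗ     ns fs = suc (⟦ t ⟧ᵗ ns fs)
⟦ t ⊕ u ⟧ᵗ     ns fs = ⟦ t ⟧ᵗ ns fs + ⟦ u ⟧ᵗ ns fs
⟦ t ⊗ u ⟧ᵗ     ns fs = ⟦ t ⟧ᵗ ns fs * ⟦ u ⟧ᵗ ns fs
⟦ ⟪ t , u ⟫ ⟧ᵗ ns fs = pair (⟦ t ⟧ᵗ ns fs) (⟦ u ⟧ᵗ ns fs)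
⟦ app j t ⟧ᵗ   ns fs = lookup fs j (⟦ t ⟧ᵗ ns fs)

⟦_⟧ᵇ : ∀ {a b} → Bounded a b → Vec ℕ a → Vec Baire b → Set
⟦ t ≐ u ⟧ᵇ    ns fs = ⟦ t ⟧ᵗ ns fs ≡ ⟦ u ⟧ᵗ ns fs
⟦ t ≼ u ⟧ᵇ    ns fs = ⟦ t ⟧ᵗ ns fs ≤ ⟦ u ⟧ᵗ ns fs
⟦ not θ ⟧ᵇ    ns fs = ¬ ⟦ θ ⟧ᵇ ns fs
⟦ θ ∧ θ' ⟧ᵇ   ns fs = ⟦ θ ⟧ᵇ ns fs × ⟦ θ' ⟧ᵇ ns fs
⟦ θ ∨ θ' ⟧ᵇ   ns fs = ⟦ θ ⟧ᵇ ns fs ⊎ ⟦ θ' ⟧ᵇ ns fs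
⟦ all< t θ ⟧ᵇ ns fs = ∀ m → m < ⟦ t ⟧ᵗ ns fs → ⟦ θ ⟧ᵇ (m ∷ ns) fs
⟦ ex< t θ ⟧ᵇ  ns fs = ∃[ m ] (m < ⟦ t ⟧ᵗ ns fs × ⟦ θ ⟧ᵇ (m ∷ ns) fs)

True : ∀ {a b} → Formula a b → Vec ℕ a → Vec Baire b → Set
True (matrix θ)   ns fs = ⟦ θ ⟧ᵇ ns fs
True (quant ∃' φ) ns fs = ∃[ n ] True φ (n ∷ ns) fs
True (quant ∀' φ) ns fs = ∀ n → True φ (n ∷ ns) fs
True (quant ∃∞ φ) ns fs = ∀ m → ∃[ n ] (m ≤ n × True φ (n ∷ ns) fs)
True (quant ∀∞ φ) ns fs = ∃[ m ] (∀ n → m ≤ n → True φ (n ∷ ns) fs)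

------------------------------------------------------------------------
-- Witnesses

-- A tuple of numbers and functions as a single element of ω^ω. A single
-- function is its own code; a tuple without functions is padded with 0^∞.
codeFunctions : ∀ {b} → Vec Baire b → Baire
codeFunctions []           = 0^∞
codeFunctions (f ∷ [])     = f
codeFunctions (f ∷ g ∷ fs) = join f (codeFunctions (g ∷ fs))

code : ∀ {a b} → Vec ℕ a → Vec Baire b → Baire
code []       fs = codeFunctions fs
code (n ∷ ns) fs = cons n (code ns fs)

-- α ⊩ φ [ ns , fs ]: α is a witness for φ(ns , fs). The cases of ∃∞ and ∀∞
-- use that ⟨ k , β ⟩ has head k and tail β.
_⊩_[_,_] : ∀ {a b} → Baire → Formula a b → Vec ℕ a → Vec Baire b → Set
α ⊩ matrix θ   [ ns , fs ] = α ≗ code ns fs × ⟦ θ ⟧ᵇ ns fs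
α ⊩ quant ∃' φ [ ns , fs ] = tail α ⊩ φ [ head α ∷ ns , fs ]
α ⊩ quant ∀' φ [ ns , fs ] = ∀ n → column α n ⊩ φ [ n ∷ ns , fs ]
α ⊩ quant ∃∞ φ [ ns , fs ] =
  ∀ n → n ≤ head (column α n) ×
        tail (column α n) ⊩ φ [ head (column α n) ∷ ns , fs ]
α ⊩ quant ∀∞ φ [ ns , fs ] =
  ∀ n → head α ≤ n → column (tail α) n ⊩ φ [ n ∷ ns , fs ]

------------------------------------------------------------------------
-- Many-one reducibility

record Instance (a b : ℕ) : Set where
  field
    numbers    : Vec ℕ a
    functions  : Vec Baire b
    computable : All Computable functions

open Instance public

⌜_⌝ : ∀ {a b} → Instance a b → Baire
⌜ x ⌝ = code (numbers x) (functions x)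

Holds : ∀ {a b} → Formula a b → Instance a b → Set
Holds φ x = True φ (numbers x) (functions x)

infix 4 _witnesses_at_ _≤ₘ_

_witnesses_at_ : ∀ {a b} → Baire → Formula a b → Instance a b → Set
α witnesses φ at x = α ⊩ φ [ numbers x , functions x ]

-- η, r₋ and r₊ may be partial: they are required to be defined on (codes
-- of) instances, respectively on pairs of a witness and an instance.
record _≤ₘ_ {a b c d : ℕ} (φ : Formula a b) (ψ : Formula c d) : Set where
  field
    η     : Program 1 1
    r₋ r₊ : Program 2 1

    image   : Instance a b → Instance c d
    η-image : ∀ x → Maps η (⌜ x ⌝ ∷ []) ⌜ image x ⌝

    truth    : ∀ x → Holds φ x ⇔ Holds ψ (image x)
    forward  : ∀ x α → α witnesses φ at x →
               ∃[ β ] (Maps r₋ (α ∷ ⌜ x ⌝ ∷ []) β ×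
                       β witnesses ψ at image x)
    backward : ∀ x α → α witnesses ψ at image x →
               ∃[ β ] (Maps r₊ (α ∷ ⌜ x ⌝ ∷ []) β ×
                       β witnesses φ at x)

------------------------------------------------------------------------
-- The two formulas

-- ∃ i ∀ t. (i = 0 ∧ x₀(t) = 0) ∨ (i = 1 ∧ x₁(t) = 0); the matrix expresses
-- i ∈ {0,1} and x_i(t) = 0.
⟨∨∀⟩ : Formula 0 2
⟨∨∀⟩ = quant ∃' (quant ∀' (matrix
         ( i ≐ zero     ∧ app zero       t ≐ zero
         ∨ i ≐ suc zero ∧ app (suc zero) t ≐ zero )))
  where
  i t : Term 2 2
  i = var (suc zero)
  t = var zero

-- ∀ n ∀^∞ t ∀ k. x(n,t,k) = 0, with x ∈ ω^(ω×ω×ω) regarded as an element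
-- of ω^ω.
⟨∀∀∞∀⟩ : Formula 0 1
⟨∀∀∞∀⟩ = quant ∀' (quant ∀∞ (quant ∀' (matrix
           (app zero ⟪ n , ⟪ t , k ⟫ ⟫ ≐ zero))))
  where
  n t k : Term 3 1
  n = var (suc (suc zero))
  t = var (suc zero)
  k = var zero

{-# OPTIONS --safe #-}

-- Let x = (0^∞ , 0^∞). The two trivial witnesses of x are sent by r₋ to
-- thresholds T₀ , T₁ : ω → ω for η(x). Thresholds may be raised, so T₀ ⊔ T₁ also
-- yields a witness for η(x), which r₊ sends to some i ∈ {0,1}. Approximate x by
-- xₘ → x whose component 1 - j is not zero and whose component j is zero. The
-- j-th witness of xₘ gives thresholds Tₘ → Tⱼ, so (T₀ ⊔ T₁) ⊔ Tₘ → T₀ ⊔ T₁ are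
-- thresholds for η(xₘ), which r₊ must send to j; by continuity i = j. This holds
-- for both j, a contradiction.
module Submission where

open import Defs
open import Data.Fin using (Fin; zero; suc; fromℕ<)
open import Data.Fin.Properties using (toℕ-fromℕ<)
open import Data.Nat using (ℕ; zero; suc; pred; _+_; _∸_; _≤_; _⊔_)
open import Data.Nat.Properties
open import Data.Product using (_×_; _,_; ∃-syntax; proj₁; proj₂; map₂)
open import Data.Sum using (inj₁; inj₂)
open import Data.Vec using (Vec; []; _∷_; lookup)
open import Data.Vec.Properties using (tabulate∘lookup; tabulate-cong)
open import Data.Vec.Relation.Unary.All using ([]; _∷_)
open import Relation.Binary using (tri<; tri≈; tri>)
open import Relation.Binary.PropositionalEquality
open import Relation.Nullary using (¬_; contradiction)

-- Inverting Cantor's pairing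

next : ℕ × ℕ → ℕ × ℕ
next (zero  , n) = suc n , 0
next (suc m , n) = m , suc n

unpair : ℕ → ℕ × ℕ
unpair zero    = 0 , 0
unpair (suc p) = next (unpair p)

pair-zero-suc : ∀ n → pair (suc n) 0 ≡ suc (pair 0 n)
pair-zero-suc n = trans (+-identityʳ _)
  (cong suc (trans (cong (λ k → k + triangle k) (+-identityʳ n)) (+-comm n (triangle n))))

pair-suc : ∀ m n → pair m (suc n) ≡ suc (pair (suc m) n)
pair-suc m n = trans (cong (λ k → triangle k + suc n) (+-suc m n)) (+-suc _ n)

-- `next` follows the order in which `pair` counts: along a diagonal, then on to the start of the
-- following one. The induction is lexicographic, on the diagonal `s` and then on the position `n`
-- in it.
unpair-pair : ∀ m n → unpair (pair m n) ≡ (m , n)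
unpair-pair m n = diagonal (m + n) n m refl
  where
  diagonal : ∀ s n m → m + n ≡ s → unpair (pair m n) ≡ (m , n)
  diagonal s       zero    zero    _  = refl
  diagonal (suc s) zero    (suc m) eq = trans (cong unpair (pair-zero-suc m))
    (cong next (diagonal s m zero (trans (sym (+-identityʳ m)) (suc-injective eq))))
  diagonal s       (suc n) m       eq = trans (cong unpair (pair-suc m n))
    (cong next (diagonal s n (suc m) (trans (sym (+-suc m n)) eq)))

fromColumns : (ℕ → Baire) → Baire
fromColumns F p = F (proj₁ (unpair p)) (proj₂ (unpair p))

column-fromColumns : ∀ F n → column (fromColumns F) n ≗ F n
column-fromColumns F n k = cong (λ p → F (proj₁ p) (proj₂ p)) (unpair-pair n k)

-- Convergence in Baire space

Eventually : (ℕ → Set) → Set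
Eventually P = ∃[ M ] (∀ m → M ≤ m → P m)

always : ∀ {P} → (∀ m → P m) → Eventually P
always h = 0 , λ m _ → h m

eventually-map : ∀ {P Q : ℕ → Set} → (∀ m → P m → Q m) → Eventually P → Eventually Q
eventually-map f = map₂ (λ h m M≤m → f m (h m M≤m))

eventually-map₂ : ∀ {P Q R : ℕ → Set} → (∀ m → P m → Q m → R m) →
                  Eventually P → Eventually Q → Eventually R
eventually-map₂ f (M , h) (N , k) = M ⊔ N , λ m M⊔N≤m →
  f m (h m (m⊔n≤o⇒m≤o M N M⊔N≤m)) (k m (m⊔n≤o⇒n≤o M N M⊔N≤m))

eventually-∀ : ∀ {k} {P : Fin k → ℕ → Set} →
               (∀ i → Eventually (P i)) → Eventually (λ m → ∀ i → P i m)
eventually-∀ {zero}  h = always λ _ ()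
eventually-∀ {suc k} h = eventually-map₂ (λ { m p ps zero → p ; m p ps (suc i) → ps i })
                           (h zero) (eventually-∀ (λ i → h (suc i)))

infix 4 _⟶_

-- Convergence in the product topology with discrete factors: the stage may depend on the argument.
_⟶_ : (ℕ → Baire) → Baire → Set
F ⟶ f = ∀ n → Eventually (λ m → F m n ≡ f n)

⟶-const : ∀ {f} → (λ _ → f) ⟶ f
⟶-const n = always λ _ → refl

⟶-cons : ∀ {T : ℕ → ℕ} {t F f} → Eventually (λ m → T m ≡ t) → F ⟶ f →
         (λ m → cons (T m) (F m)) ⟶ cons t f
⟶-cons T→t F→f zero    = T→t
⟶-cons T→t F→f (suc n) = F→f n

⟶-cons-const : ∀ t {F f} → F ⟶ f → (λ m → cons t (F m)) ⟶ cons t f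
⟶-cons-const t = ⟶-cons {λ _ → t} (always λ _ → refl)

⟶-join : ∀ {F f G g} → F ⟶ f → G ⟶ g → (λ m → join (F m) (G m)) ⟶ join f g
⟶-join F→f G→g zero    = F→f zero
⟶-join F→f G→g (suc n) = ⟶-join G→g (λ k → F→f (suc k)) n

⟶-fromColumns : ∀ {F : ℕ → ℕ → Baire} {f} → (∀ n → (λ m → F m n) ⟶ f n) →
                (λ m → fromColumns (F m)) ⟶ fromColumns f
⟶-fromColumns F→f p = F→f (proj₁ (unpair p)) (proj₂ (unpair p))

⟶-∷ : ∀ {o F f} {Γ : ℕ → Vec Baire o} {γ} → F ⟶ f →
      (∀ j → (λ m → lookup (Γ m) j) ⟶ lookup γ j) →
      ∀ j → (λ m → lookup (F m ∷ Γ m) j) ⟶ lookup (f ∷ γ) j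
⟶-∷ F→f Γ→γ zero    = F→f
⟶-∷ F→f Γ→γ (suc j) = Γ→γ j

-- Determinism and continuity of oracle computations

lookup-ext : ∀ {A : Set} {k} (xs ys : Vec A k) → lookup xs ≗ lookup ys → xs ≡ ys
lookup-ext xs ys eq =
  trans (sym (tabulate∘lookup xs)) (trans (tabulate-cong eq) (tabulate∘lookup ys))

deterministic : ∀ {o k} {γ : Vec Baire o} {p : Program o k} {xs y z} →
                γ ⊢ p [ xs ]⇓ y → γ ⊢ p [ xs ]⇓ z → y ≡ z
deterministic zero       zero       = refl
deterministic suc        suc        = refl
deterministic (proj i)   (proj .i)  = refl
deterministic (oracle j) (oracle .j) = refl
deterministic (comp ys ds d) (comp zs es e)
  with refl ← lookup-ext ys zs (λ i → deterministic (ds i) (es i)) = deterministic d e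
deterministic (prec-z d) (prec-z e) = deterministic d e
deterministic (prec-s d d′) (prec-s e e′)
  with refl ← deterministic d e = deterministic d′ e′
deterministic {γ = γ} {xs = xs} (mu {p = p} {n = n} v ds d) (mu {n = n′} w es e)
  with <-cmp n n′
... | tri≈ _ n≡n′ _ = n≡n′
-- The search ending at `n′` saw a positive value at `n`, where the other one found 0.
... | tri< n<n′ _ _ = contradiction
        (deterministic d (subst (λ a → γ ⊢ p [ a ∷ xs ]⇓ suc (w (fromℕ< n<n′)))
                                (toℕ-fromℕ< n<n′) (es (fromℕ< n<n′))))
        0≢1+n
... | tri> _ _ n′<n = contradiction
        (deterministic (ds (fromℕ< n′<n))
                       (subst (λ a → γ ⊢ p [ a ∷ xs ]⇓ 0) (sym (toℕ-fromℕ< n′<n)) e))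
        1+n≢0

module _ {o} {Γ : ℕ → Vec Baire o} {γ} (Γ→γ : ∀ j → (λ m → lookup (Γ m) j) ⟶ lookup γ j) where

  -- A derivation queries the oracles at finitely many places only, and beyond some stage `Γ m`
  -- agrees with `γ` at all of them.
  continuous : ∀ {k} {p : Program o k} {xs y} →
               γ ⊢ p [ xs ]⇓ y → Eventually (λ m → Γ m ⊢ p [ xs ]⇓ y)
  continuous zero           = always λ _ → zero
  continuous suc            = always λ _ → suc
  continuous (proj i)       = always λ _ → proj i
  continuous (oracle {n} j) = eventually-map
    (λ m eq → subst (Γ m ⊢ oracle j [ n ∷ [] ]⇓_) eq (oracle j)) (Γ→γ j n)
  continuous (comp ys ds d) = eventually-map₂ (λ _ → comp ys)
    (eventually-∀ (λ i → continuous (ds i))) (continuous d)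
  continuous (prec-z d)     = eventually-map (λ _ → prec-z) (continuous d)
  continuous (prec-s d d′)  = eventually-map₂ (λ _ → prec-s) (continuous d) (continuous d′)
  continuous (mu v ds d)    = eventually-map₂ (λ _ → mu v)
    (eventually-∀ (λ i → continuous (ds i))) (continuous d)

  Maps-⟶ : ∀ {p Δ δ} → (∀ m → Maps p (Γ m) (Δ m)) → Maps p γ δ → Δ ⟶ δ
  Maps-⟶ Γ↦Δ γ↦δ n = eventually-map (λ m → deterministic (Γ↦Δ m n)) (continuous (γ↦δ n))

-- Witnesses of the disjunction

-- The code of the matrix instance, with the innermost variable `t` first.
choiceColumn : ℕ → Baire → ℕ → Baire
choiceColumn i x t = cons t (cons i x)

choice : ℕ → Baire → Baire
choice i x = cons i (fromColumns (choiceColumn i x))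

choice-⟶ : ∀ {i X x} → X ⟶ x → (λ m → choice i (X m)) ⟶ choice i x
choice-⟶ {i} X→x = ⟶-cons-const i
  (⟶-fromColumns λ t → ⟶-cons-const t (⟶-cons-const i X→x))

choice-witness₀ : ∀ f g → f ≗ 0^∞ → choice 0 (join f g) ⊩ ⟨∨∀⟩ [ [] , f ∷ g ∷ [] ]
choice-witness₀ f g f≗0 t =
  (λ k → trans (column-fromColumns (choiceColumn 0 (join f g)) t k) (cons-code k)) ,
  inj₁ (refl , f≗0 t)
  where
  cons-code : choiceColumn 0 (join f g) t ≗ code (t ∷ 0 ∷ []) (f ∷ g ∷ [])
  cons-code zero          = refl
  cons-code (suc zero)    = refl
  cons-code (suc (suc k)) = refl

choice-witness₁ : ∀ f g → g ≗ 0^∞ → choice 1 (join f g) ⊩ ⟨∨∀⟩ [ [] , f ∷ g ∷ [] ]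
choice-witness₁ f g g≗0 t =
  (λ k → trans (column-fromColumns (choiceColumn 1 (join f g)) t k) (cons-code k)) ,
  inj₂ (refl , g≗0 t)
  where
  cons-code : choiceColumn 1 (join f g) t ≗ code (t ∷ 1 ∷ []) (f ∷ g ∷ [])
  cons-code zero          = refl
  cons-code (suc zero)    = refl
  cons-code (suc (suc k)) = refl

-- Witnesses as threshold functions

thresholds : Baire → Baire
thresholds α n = head (column α n)

-- This condition is upward closed in `T`; on that rests the merging of two witnesses into one.
Bounds : Baire → Baire → Set
Bounds T y = ∀ n t k → T n ≤ t → y (pair n (pair t k)) ≡ 0

thresholds-bounds : ∀ y α → α witnesses ⟨∀∀∞∀⟩ at y → Bounds (thresholds α) ⌜ y ⌝
thresholds-bounds record { numbers = [] ; functions = _ ∷ [] } α w n t k T≤t =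
  proj₂ (w n t T≤t k)

matrixColumn : Baire → ℕ → ℕ → ℕ → Baire
matrixColumn y n t k = cons k (cons t (cons n y))

thresholdColumn : Baire → Baire → ℕ → Baire
thresholdColumn T y n = cons (T n) (fromColumns λ t → fromColumns (matrixColumn y n t))

fromThresholds : Baire → Baire → Baire
fromThresholds T y = fromColumns (thresholdColumn T y)

-- Apart from the thresholds, a witness only repeats the instance and the quantified numbers, so it
-- can be rebuilt from `T` and `y`, continuously in both.
fromThresholds-witness : ∀ y {T} → Bounds T ⌜ y ⌝ →
                         fromThresholds T ⌜ y ⌝ witnesses ⟨∀∀∞∀⟩ at y
fromThresholds-witness record { numbers = [] ; functions = f ∷ [] } {T} bound n t T≤t k =
  (λ s → trans (column-fromColumns (thresholdColumn T f) n (suc (pair t (pair k s))))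
    (trans (column-fromColumns (λ t → fromColumns (matrixColumn f n t)) t (pair k s))
    (trans (column-fromColumns (matrixColumn f n t) k s) (cons-code s)))) ,
  bound n t k (subst (_≤ t) (column-fromColumns (thresholdColumn T f) n 0) T≤t)
  where
  cons-code : matrixColumn f n t k ≗ code (k ∷ t ∷ n ∷ []) (f ∷ [])
  cons-code zero                = refl
  cons-code (suc zero)          = refl
  cons-code (suc (suc zero))    = refl
  cons-code (suc (suc (suc s))) = refl

fromThresholds-⟶ : ∀ {S T Y y} → S ⟶ T → Y ⟶ y →
                   (λ m → fromThresholds (S m) (Y m)) ⟶ fromThresholds T y
fromThresholds-⟶ S→T Y→y = ⟶-fromColumns λ n → ⟶-cons (S→T n)
  (⟶-fromColumns λ t → ⟶-fromColumns λ k →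
    ⟶-cons-const k (⟶-cons-const t (⟶-cons-const n Y→y)))

-- The zero instance and its approximations

0^∞-computable : Computable 0^∞
0^∞-computable = comp zero [] , λ n → comp [] (λ ()) zero

∸-computable : ∀ m → Computable (_∸ m)
∸-computable zero    = proj zero , λ n → proj zero
∸-computable (suc m) with p , p↦ ← ∸-computable m =
  comp predecessor (p ∷ []) , λ n →
    comp (n ∸ m ∷ []) (λ { zero → p↦ n })
      (subst (λ k → [] ⊢ predecessor [ n ∸ m ∷ [] ]⇓ k) (pred[m∸n]≡m∸[1+n] n m)
        (predecessor-maps (n ∸ m)))
  where
  predecessor : Program 0 1
  predecessor = prec zero (proj zero)

  predecessor-maps : Maps predecessor [] pred
  predecessor-maps zero    = prec-z zero
  predecessor-maps (suc n) = prec-s (predecessor-maps n) (proj zero)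

∸-⟶0 : (λ m n → n ∸ m) ⟶ 0^∞
∸-⟶0 n = n , λ m → m≤n⇒m∸n≡0

∸≢0 : ∀ m → suc m ∸ m ≢ 0
∸≢0 m eq with () ← trans (sym (m+n∸n≡m 1 m)) eq

origin : Instance 0 2
origin = record
  { numbers    = []
  ; functions  = 0^∞ ∷ 0^∞ ∷ []
  ; computable = 0^∞-computable ∷ 0^∞-computable ∷ []
  }

-- The subscript names the component that stays zero. The other one, `_∸ m`, vanishes up to `m` but
-- not at `suc m`.
near₀ near₁ : ℕ → Instance 0 2
near₀ m = record
  { numbers    = []
  ; functions  = 0^∞ ∷ (_∸ m) ∷ []
  ; computable = 0^∞-computable ∷ ∸-computable m ∷ []
  }
near₁ m = record
  { numbers    = []
  ; functions  = (_∸ m) ∷ 0^∞ ∷ []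
  ; computable = ∸-computable m ∷ 0^∞-computable ∷ []
  }

near₀-forces : ∀ m δ → δ witnesses ⟨∨∀⟩ at near₀ m → head δ ≡ 0
near₀-forces m δ w with proj₂ (w (suc m))
... | inj₁ (i≡0 , _)   = i≡0
... | inj₂ (_ , val≡0) = contradiction val≡0 (∸≢0 m)

near₁-forces : ∀ m δ → δ witnesses ⟨∨∀⟩ at near₁ m → head δ ≡ 1
near₁-forces m δ w with proj₂ (w (suc m))
... | inj₁ (_ , val≡0) = contradiction val≡0 (∸≢0 m)
... | inj₂ (i≡1 , _)   = i≡1

-- Forcing the answer at the limit

module _ {a b} {φ : Formula a b} (reduction : φ ≤ₘ ⟨∀∀∞∀⟩) where
  open _≤ₘ_ reduction

  -- `T` only has to dominate the thresholds of `β`, so that one `T`, and hence one `δ`, can serve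
  -- two different approximations of `x`.
  forced : ∀ (X : ℕ → Instance a b) x (A : ℕ → Baire) α i →
           (λ m → ⌜ X m ⌝) ⟶ ⌜ x ⌝ → A ⟶ α →
           (∀ m → A m witnesses φ at X m) →
           (∀ m δ → δ witnesses φ at X m → head δ ≡ i) →
           ∀ β → Maps r₋ (α ∷ ⌜ x ⌝ ∷ []) β →
           ∀ T → (∀ n → thresholds β n ≤ T n) →
           ∀ δ → Maps r₊ (fromThresholds T ⌜ image x ⌝ ∷ ⌜ x ⌝ ∷ []) δ →
           head δ ≡ i
  forced X x A α i X→x A→α A⊩X X-forces β α↦β T β≤T δ T↦δ =
    -- From stage `M` on, the answers for `X m` have the same head as `δ`.
    let M , Δ→δ = Maps-⟶ (⟶-∷ W→w (⟶-∷ X→x λ ())) (λ m → proj₁ (proj₂ (answer m))) T↦δ 0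
    in trans (sym (Δ→δ M ≤-refl)) (X-forces M _ (proj₂ (proj₂ (answer M))))
    where
    B : ℕ → Baire
    B m = proj₁ (forward (X m) (A m) (A⊩X m))

    B→β : B ⟶ β
    B→β = Maps-⟶ (⟶-∷ A→α (⟶-∷ X→x λ ()))
            (λ m → proj₁ (proj₂ (forward (X m) (A m) (A⊩X m)))) α↦β

    Y→y : (λ m → ⌜ image (X m) ⌝) ⟶ ⌜ image x ⌝
    Y→y = Maps-⟶ (⟶-∷ X→x λ ()) (λ m → η-image (X m)) (η-image x)

    -- The right half makes `S m` valid for `image (X m)`; the left half makes the limit `T`, since
    -- the right half converges to something below `T`.
    S : ℕ → Baire
    S m n = T n ⊔ thresholds (B m) n

    S→T : S ⟶ T
    S→T n = eventually-map (λ m eq → trans (cong (T n ⊔_) eq) (m≥n⇒m⊔n≡m (β≤T n)))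
              -- The `n`-th threshold is the single entry at `pair n 0`.
              (B→β (pair n 0))

    W : ℕ → Baire
    W m = fromThresholds (S m) ⌜ image (X m) ⌝

    W→w : W ⟶ fromThresholds T ⌜ image x ⌝
    W→w = fromThresholds-⟶ S→T Y→y

    S-bounds : ∀ m → Bounds (S m) ⌜ image (X m) ⌝
    S-bounds m n t k S≤t =
      thresholds-bounds (image (X m)) (B m) (proj₂ (proj₂ (forward (X m) (A m) (A⊩X m))))
        n t k (m⊔n≤o⇒n≤o (T n) _ S≤t)

    answer : ∀ m → ∃[ Δ ] (Maps r₊ (W m ∷ ⌜ X m ⌝ ∷ []) Δ × Δ witnesses φ at X m)
    answer m = backward (X m) (W m) (fromThresholds-witness (image (X m)) (S-bounds m))

proposition4p11 : ¬ (⟨∨∀⟩ ≤ₘ ⟨∀∀∞∀⟩)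
proposition4p11 reduction =
  let β₀ , α₀↦β₀ , β₀⊩ = forward origin (choice 0 ⌜ origin ⌝) (choice-witness₀ _ _ λ _ → refl)
      β₁ , α₁↦β₁ , _   = forward origin (choice 1 ⌜ origin ⌝) (choice-witness₁ _ _ λ _ → refl)
      -- Dominating both threshold functions lets `forced` apply twice to the same `δ`.
      T n = thresholds β₀ n ⊔ thresholds β₁ n
      T-bounds n t k T≤t = thresholds-bounds (image origin) β₀ β₀⊩ n t k
        (m⊔n≤o⇒m≤o _ (thresholds β₁ n) T≤t)
      δ , T↦δ , _ = backward origin (fromThresholds T ⌜ image origin ⌝)
        (fromThresholds-witness (image origin) T-bounds)
      -- Component 0 of `near₀ m` is zero for every `m`, so choice 0 is a witness all along the
      -- sequence.
      δ≡0 = forced reduction near₀ origin _ _ 0 near₀→ (choice-⟶ near₀→)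
        (λ m → choice-witness₀ _ _ λ _ → refl) near₀-forces
        β₀ α₀↦β₀ T (λ n → m≤m⊔n _ _) δ T↦δ
      δ≡1 = forced reduction near₁ origin _ _ 1 near₁→ (choice-⟶ near₁→)
        (λ m → choice-witness₁ _ _ λ _ → refl) near₁-forces
        β₁ α₁↦β₁ T (λ n → m≤n⊔m _ _) δ T↦δ
  in contradiction (trans (sym δ≡0) δ≡1) λ ()
  where
  open _≤ₘ_ reduction

  near₀→ : (λ m → ⌜ near₀ m ⌝) ⟶ ⌜ origin ⌝
  near₀→ = ⟶-join ⟶-const ∸-⟶0

  near₁→ : (λ m → ⌜ near₁ m ⌝) ⟶ ⌜ origin ⌝
  near₁→ = ⟶-join ∸-⟶0 ⟶-const
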